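{- Let $G$ be a finite simple connected graph with $|E(G)|>\nu_2(G)$ and $\nu_2(G)\ge 5$. Then $\gamma(G)=\nu_2(G)-1$ if and only if $G$ is isomorphic to $T^{\nu_2(G)}_{s,t}$ for some positive integers $s,t$ with $s+4=\nu_2(G)$.
   Context: A 2-packing of a graph $G$ is a set $R\subseteq E(G)$ such that no three edges of $R$ are incident with a common vertex; $\nu_2(G)$ is the maximum size of a 2-packing. $\gamma(G)$ is the domination number: the minimum size of a set $D\subseteq V(G)$ such that every vertex is in $D$ or adjacent to a vertex of $D$. For positive integers $s,t$ and $r=s+4$, $T^{r}_{s,t}$ is the tree with vertex set $\{v_0,\ldots,v_4\}\cup\{p_1,\ldots,p_s\}\cup\{q_1,\ldots,q_s\}\cup\{w_1,\ldots,w_t\}$ (all distinct) and edge set $\{v_0v_1,v_1v_2,v_2v_3,v_3v_4\}\cup\{p_iq_i:1\le i\le s\}\cup\{v_2w_i:1\le i\le t\}\cup\{v_2p_i:1\le i\le s\}$. -}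

module Defs where

open import Data.Nat using (ℕ; zero; suc; _+_; _≤_; _<_; _≡ᵇ_)
open import Data.Bool using (Bool; true; false; if_then_else_; _∧_; _∨_)
open import Data.Fin using (Fin; toℕ; _<?_)
open import Data.List using (List; []; _∷_; _++_; map; upTo)
open import Data.Bool.ListAction using (any)
open import Data.Product using (Σ; _×_; _,_; ∃)
open import Data.Sum using (_⊎_)
open import Relation.Binary.PropositionalEquality using (_≡_)
open import Relation.Nullary.Decidable using (⌊_⌋)
open import Function.Bundles using (_↔_; Inverse)

record Graph (n : ℕ) : Set where
  field
    Adj    : Fin n → Fin n → Bool
    sym    : ∀ i j → Adj i j ≡ Adj j i
    irrefl : ∀ i → Adj i i ≡ false
open Graph public

sumFin : ∀ {n} → (Fin n → ℕ) → ℕ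
sumFin {zero}  f = 0
sumFin {suc n} f = f Fin.zero + sumFin (λ i → f (Fin.suc i))

b2n : Bool → ℕ
b2n true  = 1
b2n false = 0

sizeV : ∀ {n} → (Fin n → Bool) → ℕ
sizeV D = sumFin (λ i → b2n (D i))

sizeE : ∀ {n} → (Fin n → Fin n → Bool) → ℕ
sizeE R = sumFin (λ i → sumFin (λ j → b2n (⌊ i <? j ⌋ ∧ R i j)))

edgeCount : ∀ {n} → Graph n → ℕ
edgeCount G = sizeE (Adj G)

degIn : ∀ {n} → (Fin n → Fin n → Bool) → Fin n → ℕ
degIn R v = sumFin (λ j → b2n (R v j))

data Reach {n} (G : Graph n) : Fin n → Fin n → Set where
  here : ∀ {u} → Reach G u u
  step : ∀ {u v w} → Adj G u v ≡ true → Reach G v w → Reach G u w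

Connected : ∀ {n} → Graph n → Set
Connected G = ∀ u v → Reach G u v

-- An edge set R ⊆ E(G) (given as a symmetric Boolean relation contained in Adj)
-- is a 2-packing if no three edges of R are incident with a common vertex,
-- i.e. every vertex is incident with at most two edges of R.
record IsTwoPacking {n} (G : Graph n) (R : Fin n → Fin n → Bool) : Set where
  field
    sub    : ∀ i j → R i j ≡ true → Adj G i j ≡ true
    symR   : ∀ i j → R i j ≡ R j i
    deg≤2  : ∀ v → degIn R v ≤ 2

IsNu2 : ∀ {n} → Graph n → ℕ → Set
IsNu2 G k =
  (Σ (_ → _ → Bool) λ R → IsTwoPacking G R × sizeE R ≡ k) ×
  (∀ R → IsTwoPacking G R → sizeE R ≤ k)

Dominating : ∀ {n} → Graph n → (Fin n → Bool) → Set
Dominating G D = ∀ v → D v ≡ true ⊎ ∃ λ u → D u ≡ true × Adj G u v ≡ true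

IsGamma : ∀ {n} → Graph n → ℕ → Set
IsGamma G k =
  (Σ (_ → Bool) λ D → Dominating G D × sizeV D ≡ k) ×
  (∀ D → Dominating G D → k ≤ sizeV D)

-- The tree T^{s+4}_{s,t} on vertex set Fin (5 + s + s + t), numbered
--   v_k ↦ k (0 ≤ k ≤ 4),  p_i ↦ 4 + i,  q_i ↦ 4 + s + i,  w_i ↦ 4 + s + s + i
-- (1 ≤ i ≤ s resp. 1 ≤ i ≤ t); below i ranges over upTo = 0,…,count-1.
Tsize : ℕ → ℕ → ℕ
Tsize s t = 5 + s + s + t

Tedges : ℕ → ℕ → List (ℕ × ℕ)
Tedges s t =
  ((0 , 1) ∷ (1 , 2) ∷ (2 , 3) ∷ (3 , 4) ∷ [])
  ++ map (λ i → (5 + i , 5 + s + i)) (upTo s)       -- p_i q_i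
  ++ map (λ i → (2 , 5 + s + s + i)) (upTo t)       -- v_2 w_i
  ++ map (λ i → (2 , 5 + i)) (upTo s)               -- v_2 p_i

TAdj : (s t : ℕ) → Fin (Tsize s t) → Fin (Tsize s t) → Bool
TAdj s t x y = any match (Tedges s t)
  where
  match : ℕ × ℕ → Bool
  match (a , b) = ((a ≡ᵇ toℕ x) ∧ (b ≡ᵇ toℕ y)) ∨ ((a ≡ᵇ toℕ y) ∧ (b ≡ᵇ toℕ x))

IsoT : ∀ {n} → Graph n → ℕ → ℕ → Set
IsoT {n} G s t =
  Σ (Fin n ↔ Fin (Tsize s t)) λ f →
    ∀ i j → Adj G i j ≡ TAdj s t (Inverse.to f i) (Inverse.to f j)

{-# OPTIONS --safe #-}
module Submission where

-- Write γ = ν₂ - 1. A matching with fewer than γ edges can always be augmented, for otherwise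
-- choosing a suitable end of each of its edges would give a dominating set that is too small. So
-- there is a matching M with exactly γ edges. Two edges outside M must meet in a vertex of M, since
-- otherwise adding both to M gives a 2-packing with γ + 2 > ν₂ edges. As γ ≥ 4 and the graph is
-- connected, the edges outside M cannot form a triangle, so they all pass through one vertex c of M.
-- Hence the graph is a spider with body c, the M-edge at c and the unmatched vertices being its
-- pendants and the other M-edges its legs; a leg with both ends adjacent to c would again allow a
-- dominating set that is too small.
-- Conversely, the classes {foot, toe} and {c, pendants} bound γ of a spider from below.

open import Defs
open import Data.Nat using (ℕ; zero; suc; _+_; _∸_; _≤_; _<_; _≡ᵇ_; z≤n; s≤s; s≤s⁻¹)
open import Data.Nat.Properties using (≤-refl; ≤-trans; ≤-reflexive; ≤-antisym; ≤-<-trans; <-≤-trans; <-irrefl; n≤1+n; m≤n⇒m≤1+n; +-mono-≤; +-mono-<-≤; +-mono-≤-<; +-suc; +-comm; suc-injective; ≡⇒≡ᵇ; ≡ᵇ⇒≡)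
open import Data.Bool using (Bool; true; false; T; _∧_; _∨_; if_then_else_)
open import Data.Bool.ListAction using (any)
import Data.Bool.Properties as Bool
open import Data.Fin using (Fin; zero; suc; toℕ; _<?_)
import Data.Fin as Fin
open import Data.Fin.Properties using (_≟_; any?)
import Data.Fin.Properties as Fin
open import Data.List using (List; []; _∷_; map; length; filter; allFin; lookup; upTo; tabulate)
open import Data.List.Properties using (filter-notAll; length-map; length-tabulate)
open import Data.List.Relation.Unary.Any as Any using (Any; here; there)
open import Data.List.Relation.Unary.Any.Properties using (lookup-index; any⁺; any⁻)
open import Data.List.Relation.Unary.All as All using (All; []; _∷_)
open import Data.List.Relation.Unary.All.Properties using (¬Any⇒All¬; All¬⇒¬Any)
open import Data.List.Relation.Unary.AllPairs using ([]; _∷_)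
open import Data.List.Relation.Unary.Unique.Propositional using (Unique)
import Data.List.Relation.Unary.Unique.Propositional.Properties as Unique
open import Data.List.Membership.Propositional using (_∈_; _∉_; find; lose)
open import Data.List.Membership.Propositional.Properties using (∈-filter⁺; ∈-filter⁻; ∈-map⁺; ∈-map⁻; ∈-++⁺ˡ; ∈-++⁺ʳ; ∈-++⁻; ∈-upTo⁺; ∈-upTo⁻; ∈-tabulate⁺; ∈-tabulate⁻; ∈-allFin; ∈-lookup)
open import Data.List.Relation.Binary.Permutation.Propositional using (_↭_; ↭⇒↭ₛ; ↭-refl; ↭-trans; ↭-sym; prep; swap)
open import Data.List.Relation.Binary.Permutation.Propositional.Properties using (∈-resp-↭)
import Data.List.Relation.Binary.Permutation.Setoid.Properties as PermSetoid
open import Data.Product using (Σ; _×_; _,_; ∃; proj₁; proj₂)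
open import Data.Sum as Sum using (_⊎_; inj₁; inj₂; [_,_])
open import Data.Sum.Function.Propositional using (_⊎-↔_)
open import Data.Empty using (⊥; ⊥-elim)
open import Function using (_∘_; case_of_)
open import Function.Bundles using (_⇔_; _↔_; mk⇔; mk↔ₛ′; Equivalence; Inverse)
open import Function.Construct.Composition using (_⇔-∘_; _↔-∘_)
open import Function.Construct.Identity using (↔-id)
open import Function.Construct.Symmetry using (↔-sym; ⇔-sym)
open import Relation.Binary.Definitions using (tri<; tri≈; tri>)
open import Relation.Binary.PropositionalEquality using (_≡_; _≢_; refl; trans; cong; cong₂; subst; subst₂; setoid) renaming (sym to ≡-sym)
open import Relation.Nullary using (¬_; Dec; yes; no; does; contradiction)
open import Relation.Nullary.Decidable using (⌊_⌋; ¬?; _×-dec_; _⊎-dec_; dec-true; dec-false; does-⇔; decidable-stable)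

-- Comparing finite sums and sizes of edge sets

does⇒ : ∀ {A : Set} (A? : Dec A) → does A? ≡ true → A
does⇒ (yes a) _ = a

b2n-mono : ∀ {p q} → (p ≡ true → q ≡ true) → b2n p ≤ b2n q
b2n-mono {false} _ = z≤n
b2n-mono {true} h rewrite h refl = ≤-refl

b2n-mono-< : ∀ {p q} → p ≡ false → q ≡ true → b2n p < b2n q
b2n-mono-< refl refl = ≤-refl

b2n≤1 : ∀ p → b2n p ≤ 1
b2n≤1 false = z≤n
b2n≤1 true = ≤-refl

sumFin-mono : ∀ {n} {f g : Fin n → ℕ} → (∀ i → f i ≤ g i) → sumFin f ≤ sumFin g
sumFin-mono {zero} _ = z≤n
sumFin-mono {suc n} h = +-mono-≤ (h zero) (sumFin-mono (h ∘ suc))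

sumFin-mono-< : ∀ {n} {f g : Fin n → ℕ} → (∀ i → f i ≤ g i) →
  ∀ a → f a < g a → sumFin f < sumFin g
sumFin-mono-< h zero lt = +-mono-<-≤ lt (sumFin-mono (h ∘ suc))
sumFin-mono-< h (suc a) lt = +-mono-≤-< (h zero) (sumFin-mono-< (h ∘ suc) a lt)

-- Only the summand at `a` may grow, and by one at most. With it, one more vertex in a list or one
-- more edge at a vertex raises a count by at most one.
sumFin-≤-suc : ∀ {n} {f g : Fin n → ℕ} a → f a ≤ suc (g a) →
  (∀ i → i ≢ a → f i ≤ g i) → sumFin f ≤ suc (sumFin g)
sumFin-≤-suc zero p q = +-mono-≤ p (sumFin-mono (λ i → q (suc i) λ ()))
sumFin-≤-suc (suc a) p q = ≤-trans
  (+-mono-≤ (q zero λ ()) (sumFin-≤-suc a p (λ i i≢a → q (suc i) (i≢a ∘ Fin.suc-injective))))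
  (≤-reflexive (+-suc _ _))

sumFin-zero : ∀ {n} {f : Fin n → ℕ} → (∀ i → f i ≤ 0) → sumFin f ≤ 0
sumFin-zero {zero} _ = z≤n
sumFin-zero {suc n} h = +-mono-≤ (h zero) (sumFin-zero (h ∘ suc))

-- `sizeE` counts an edge only at its increasing pair of ends, so the new pair must satisfy `a < b`
-- to be seen.
sizeE-mono-< : ∀ {n} {R S : Fin n → Fin n → Bool} → (∀ i j → R i j ≡ true → S i j ≡ true) →
  ∀ {a b} → a Fin.< b → R a b ≡ false → S a b ≡ true → sizeE R < sizeE S
sizeE-mono-< {R = R} {S} R⊆S {a} {b} a<b Rab Sab =
  sumFin-mono-< (λ i → sumFin-mono (le i)) a (sumFin-mono-< (le a) b lt)
  where
  le : ∀ i j → b2n (⌊ i <? j ⌋ ∧ R i j) ≤ b2n (⌊ i <? j ⌋ ∧ S i j)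
  le i j with i <? j
  ... | yes _ = b2n-mono (R⊆S i j)
  ... | no _ = z≤n
  lt : b2n (⌊ a <? b ⌋ ∧ R a b) < b2n (⌊ a <? b ⌋ ∧ S a b)
  lt with a <? b
  ... | yes _ = b2n-mono-< Rab Sab
  ... | no a≮b = contradiction a<b a≮b

-- Vertex lists as vertex sets

module _ {n : ℕ} where

  open import Data.List.Membership.DecPropositional (_≟_ {n}) using (_∈?_)

  members : List (Fin n) → Fin n → Bool
  members xs v = does (v ∈? xs)

  members-∈ : ∀ {xs v} → v ∈ xs → members xs v ≡ true
  members-∈ {xs} {v} = dec-true (v ∈? xs)

  sizeV-members≤ : ∀ xs → sizeV (members xs) ≤ length xs
  sizeV-members≤ [] = sumFin-zero {n} λ _ → z≤n
  sizeV-members≤ (x ∷ xs) = ≤-trans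
    (sumFin-≤-suc {g = b2n ∘ members xs} x (≤-trans (b2n≤1 _) (s≤s z≤n)) rest)
    (s≤s (sizeV-members≤ xs))
    where
    rest : ∀ i → i ≢ x → b2n (members (x ∷ xs) i) ≤ b2n (members xs i)
    rest i i≢x = b2n-mono λ p → members-∈ {xs} (case does⇒ (i ∈? x ∷ xs) p of λ where
      (here i≡x) → contradiction i≡x i≢x
      (there i∈xs) → i∈xs)

  Unique⇒length≤sizeV-members : ∀ {xs} → Unique xs → length xs ≤ sizeV (members xs)
  Unique⇒length≤sizeV-members [] = z≤n
  Unique⇒length≤sizeV-members {x ∷ xs} (x∉xs ∷ u) = ≤-<-trans (Unique⇒length≤sizeV-members u)
    (sumFin-mono-< (λ i → b2n-mono (λ p → members-∈ {x ∷ xs} (there (does⇒ (i ∈? xs) p)))) x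
      (b2n-mono-< (dec-false (x ∈? xs) (All¬⇒¬Any x∉xs)) (members-∈ {x ∷ xs} (here refl))))

  length≤sizeV : ∀ {xs D} → Unique xs → (∀ {v} → v ∈ xs → D v ≡ true) → length xs ≤ sizeV D
  length≤sizeV {xs} u h = ≤-trans (Unique⇒length≤sizeV-members u)
    (sumFin-mono (λ i → b2n-mono (h ∘ does⇒ (i ∈? xs))))

Unique⇒lookup-injective : ∀ {A : Set} {xs : List A} → Unique xs → ∀ i j → lookup xs i ≡ lookup xs j → i ≡ j
Unique⇒lookup-injective (_ ∷ _) zero zero _ = refl
Unique⇒lookup-injective (x∉ ∷ _) zero (suc j) eq = contradiction eq (All.lookup x∉ (∈-lookup j))
Unique⇒lookup-injective (x∉ ∷ _) (suc i) zero eq = contradiction (≡-sym eq) (All.lookup x∉ (∈-lookup i))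
Unique⇒lookup-injective (_ ∷ u) (suc i) (suc j) eq = cong suc (Unique⇒lookup-injective u i j eq)

-- Edge lists, their degrees and rearrangements

Edges : ℕ → Set
Edges n = List (Fin n × Fin n)

module _ {n : ℕ} where

  open import Data.List.Membership.DecPropositional (_≟_ {n}) using (_∈?_)

  -- Repetitions are kept, so `Unique (ends es)` says both that the edges are pairwise disjoint and
  -- that none is a loop.
  ends : Edges n → List (Fin n)
  ends [] = []
  ends ((a , b) ∷ es) = a ∷ b ∷ ends es

  Joins : Edges n → Fin n → Fin n → Set
  Joins es a b = Any (λ e → (proj₁ e ≡ a × proj₂ e ≡ b) ⊎ (proj₁ e ≡ b × proj₂ e ≡ a)) es

  joins? : ∀ es a b → Dec (Joins es a b)
  joins? es a b = Any.any?
    (λ e → (proj₁ e ≟ a ×-dec proj₂ e ≟ b) ⊎-dec (proj₁ e ≟ b ×-dec proj₂ e ≟ a)) es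

  joins-sym : ∀ {es a b} → Joins es a b → Joins es b a
  joins-sym = Any.map [ inj₂ , inj₁ ]

  joins-endˡ : ∀ {es a b} → Joins es a b → a ∈ ends es
  joins-endˡ (here (inj₁ (refl , _))) = here refl
  joins-endˡ (here (inj₂ (_ , refl))) = there (here refl)
  joins-endˡ (there j) = there (there (joins-endˡ j))

  ∈⇒joins : ∀ {es a b} → (a , b) ∈ es → Joins es a b
  ∈⇒joins = Any.map λ { refl → inj₁ (refl , refl) }

  ends⇒∈ : ∀ {es v} → v ∈ ends es → ∃ λ w → (v , w) ∈ es ⊎ (w , v) ∈ es
  ends⇒∈ {(a , b) ∷ es} (here refl) = b , inj₁ (here refl)
  ends⇒∈ {(a , b) ∷ es} (there (here refl)) = a , inj₂ (here refl)
  ends⇒∈ {(a , b) ∷ es} (there (there v∈)) with w , h ← ends⇒∈ v∈ =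
    w , [ inj₁ ∘ there , inj₂ ∘ there ] h

  partner-unique : ∀ {es x y z} → Unique (ends es) → Joins es x y → Joins es x z → y ≡ z
  partner-unique _ (here (inj₁ (refl , refl))) (here (inj₁ (_ , refl))) = refl
  partner-unique ((a≢b ∷ _) ∷ _) (here (inj₁ (refl , refl))) (here (inj₂ (_ , b≡a))) = contradiction (≡-sym b≡a) a≢b
  partner-unique ((a≢b ∷ _) ∷ _) (here (inj₂ (refl , refl))) (here (inj₁ (a≡b , _))) = contradiction a≡b a≢b
  partner-unique _ (here (inj₂ (refl , refl))) (here (inj₂ (refl , _))) = refl
  partner-unique ((_ ∷ a∉) ∷ _) (here (inj₁ (refl , _))) (there k) = contradiction (joins-endˡ k) (All¬⇒¬Any a∉)
  partner-unique (_ ∷ b∉ ∷ _) (here (inj₂ (_ , refl))) (there k) = contradiction (joins-endˡ k) (All¬⇒¬Any b∉)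
  partner-unique ((_ ∷ a∉) ∷ _) (there j) (here (inj₁ (refl , _))) = contradiction (joins-endˡ j) (All¬⇒¬Any a∉)
  partner-unique (_ ∷ b∉ ∷ _) (there j) (here (inj₂ (_ , refl))) = contradiction (joins-endˡ j) (All¬⇒¬Any b∉)
  partner-unique (_ ∷ _ ∷ u) (there j) (there k) = partner-unique u j k

  lookup-end : ∀ {es v} i → v ∈ proj₁ (lookup es i) ∷ proj₂ (lookup es i) ∷ [] → v ∈ ends es
  lookup-end {_ ∷ _} zero (here refl) = here refl
  lookup-end {_ ∷ _} zero (there (here refl)) = there (here refl)
  lookup-end {_ ∷ _} (suc i) p = there (there (lookup-end i p))

  private
    first∉ : ∀ {a b v} {xs : List (Fin n)} → All (a ≢_) (b ∷ xs) → All (b ≢_) xs →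
      v ∈ a ∷ b ∷ [] → v ∉ xs
    first∉ (_ ∷ a∉) _ (here refl) = All¬⇒¬Any a∉
    first∉ _ b∉ (there (here refl)) = All¬⇒¬Any b∉

  edgeRel : Edges n → Fin n → Fin n → Bool
  edgeRel es i j = does (joins? es i j)

  edgeRel-sym : ∀ es i j → edgeRel es i j ≡ edgeRel es j i
  edgeRel-sym es i j = does-⇔ (mk⇔ joins-sym joins-sym) (joins? es i j) (joins? es j i)

  private
    edgeRel-there : ∀ e es i j → edgeRel es i j ≡ true → edgeRel (e ∷ es) i j ≡ true
    edgeRel-there e es i j p = dec-true (joins? (e ∷ es) i j) (there (does⇒ (joins? es i j) p))

    edgeRel-uncons : ∀ a b es i j → ¬ (a ≡ i × b ≡ j) → ¬ (a ≡ j × b ≡ i) →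
      b2n (edgeRel ((a , b) ∷ es) i j) ≤ b2n (edgeRel es i j)
    edgeRel-uncons a b es i j p q = b2n-mono λ h → dec-true (joins? es i j)
      (case does⇒ (joins? ((a , b) ∷ es) i j) h of λ where
        (here (inj₁ r)) → contradiction r p
        (here (inj₂ r)) → contradiction r q
        (there k) → k)

  sizeE-edgeRel-∷ : ∀ {a b es} → a ≢ b → ¬ Joins es a b →
    sizeE (edgeRel es) < sizeE (edgeRel ((a , b) ∷ es))
  -- The new edge is counted at whichever order of its ends is increasing.
  sizeE-edgeRel-∷ {a} {b} {es} a≢b ¬j with Fin.<-cmp a b
  ... | tri< a<b _ _ = sizeE-mono-< (edgeRel-there (a , b) es) a<b
    (dec-false (joins? es a b) ¬j) (dec-true (joins? ((a , b) ∷ es) a b) (here (inj₁ (refl , refl))))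
  ... | tri≈ _ a≡b _ = contradiction a≡b a≢b
  ... | tri> _ _ b<a = sizeE-mono-< (edgeRel-there (a , b) es) b<a
    (dec-false (joins? es b a) (¬j ∘ joins-sym)) (dec-true (joins? ((a , b) ∷ es) b a) (here (inj₂ (refl , refl))))

  length≤sizeE-edgeRel : ∀ {es} → Unique (ends es) → length es ≤ sizeE (edgeRel es)
  length≤sizeE-edgeRel {[]} _ = z≤n
  length≤sizeE-edgeRel {_ ∷ _} ((a≢b ∷ a∉) ∷ _ ∷ u) = ≤-<-trans (length≤sizeE-edgeRel u)
    (sizeE-edgeRel-∷ a≢b (All¬⇒¬Any a∉ ∘ joins-endˡ))

  degIn-∉ : ∀ {es v} → v ∉ ends es → degIn (edgeRel es) v ≤ 0
  degIn-∉ {es} {v} v∉ = sumFin-zero {n} λ j →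
    ≤-reflexive (cong b2n (dec-false (joins? es v j) (v∉ ∘ joins-endˡ)))

  degIn-∷-∉ : ∀ a b es {v} → v ≢ a → v ≢ b → degIn (edgeRel ((a , b) ∷ es)) v ≤ degIn (edgeRel es) v
  degIn-∷-∉ a b es {v} v≢a v≢b = sumFin-mono {n} λ j →
    edgeRel-uncons a b es v j (v≢a ∘ ≡-sym ∘ proj₁) (v≢b ∘ ≡-sym ∘ proj₂)

  degIn-∷ : ∀ a b es v → degIn (edgeRel ((a , b) ∷ es)) v ≤ suc (degIn (edgeRel es) v)
  degIn-∷ a b es v with v ≟ a | v ≟ b
  ... | yes refl | _ = sumFin-≤-suc b (≤-trans (b2n≤1 _) (s≤s z≤n))
    λ j j≢b → edgeRel-uncons a b es v j (j≢b ∘ ≡-sym ∘ proj₂) λ (a≡j , b≡a) → j≢b (≡-sym (trans b≡a a≡j))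
  ... | no v≢a | yes refl = sumFin-≤-suc a (≤-trans (b2n≤1 _) (s≤s z≤n))
    λ j j≢a → edgeRel-uncons a b es v j (v≢a ∘ ≡-sym ∘ proj₁) (j≢a ∘ ≡-sym ∘ proj₁)
  ... | no v≢a | no v≢b = m≤n⇒m≤1+n (degIn-∷-∉ a b es v≢a v≢b)

  degIn-Unique : ∀ {es} → Unique (ends es) → ∀ v → degIn (edgeRel es) v ≤ 1
  degIn-Unique {[]} _ v = m≤n⇒m≤1+n (degIn-∉ {[]} {v} λ ())
  degIn-Unique {(a , b) ∷ es} ((_ ∷ a∉) ∷ b∉ ∷ u) v with v ∈? ends es
  ... | no v∉ = ≤-trans (degIn-∷ a b es v) (s≤s (degIn-∉ {es} v∉))
  ... | yes v∈ = ≤-trans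
    (degIn-∷-∉ a b es (λ { refl → All¬⇒¬Any a∉ v∈ }) (λ { refl → All¬⇒¬Any b∉ v∈ }))
    (degIn-Unique u v)

  -- Disjointness in terms of positions; it later makes the labelling of feet and toes by leg
  -- indices injective.
  lookup-end-unique : ∀ {es} → Unique (ends es) → ∀ {v} i j →
    v ∈ proj₁ (lookup es i) ∷ proj₂ (lookup es i) ∷ [] →
    v ∈ proj₁ (lookup es j) ∷ proj₂ (lookup es j) ∷ [] → i ≡ j
  lookup-end-unique {_ ∷ _} _ zero zero _ _ = refl
  lookup-end-unique {_ ∷ _} (a∉ ∷ b∉ ∷ _) zero (suc j) p q = ⊥-elim (first∉ a∉ b∉ p (lookup-end j q))
  lookup-end-unique {_ ∷ _} (a∉ ∷ b∉ ∷ _) (suc i) zero p q = ⊥-elim (first∉ a∉ b∉ q (lookup-end i p))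
  lookup-end-unique {_ ∷ _} (_ ∷ _ ∷ u) (suc i) (suc j) p q = cong suc (lookup-end-unique u i j p q)

  infix 4 _≃_
  -- Permutation of the list together with flips of single edges: the undirected edges stay the
  -- same, while a chosen edge can be brought to the front with a chosen end first.
  data _≃_ : Edges n → Edges n → Set where
    ≃-refl  : ∀ {es} → es ≃ es
    ≃-prep  : ∀ e {es fs} → es ≃ fs → e ∷ es ≃ e ∷ fs
    ≃-flip  : ∀ a b {es fs} → es ≃ fs → (a , b) ∷ es ≃ (b , a) ∷ fs
    ≃-swap  : ∀ e f {es} → e ∷ f ∷ es ≃ f ∷ e ∷ es
    ≃-trans : ∀ {es fs gs} → es ≃ fs → fs ≃ gs → es ≃ gs

  ends-↭ : ∀ {es fs} → es ≃ fs → ends es ↭ ends fs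
  ends-↭ ≃-refl = ↭-refl
  ends-↭ (≃-prep (a , b) p) = prep a (prep b (ends-↭ p))
  ends-↭ (≃-flip a b p) = swap a b (ends-↭ p)
  ends-↭ (≃-swap (a , b) (c , d)) = ↭-trans (prep a (swap b c ↭-refl))
    (↭-trans (swap a c (swap b d ↭-refl)) (prep c (swap a d ↭-refl)))
  ends-↭ (≃-trans p q) = ↭-trans (ends-↭ p) (ends-↭ q)

  ≃-length : ∀ {es fs} → es ≃ fs → length es ≡ length fs
  ≃-length ≃-refl = refl
  ≃-length (≃-prep _ p) = cong suc (≃-length p)
  ≃-length (≃-flip _ _ p) = cong suc (≃-length p)
  ≃-length (≃-swap _ _) = refl
  ≃-length (≃-trans p q) = trans (≃-length p) (≃-length q)

  joins-resp-≃ : ∀ {es fs a b} → es ≃ fs → Joins es a b → Joins fs a b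
  joins-resp-≃ ≃-refl j = j
  joins-resp-≃ (≃-prep _ p) (here h) = here h
  joins-resp-≃ (≃-prep _ p) (there j) = there (joins-resp-≃ p j)
  joins-resp-≃ (≃-flip _ _ p) (here (inj₁ (h , k))) = here (inj₂ (k , h))
  joins-resp-≃ (≃-flip _ _ p) (here (inj₂ (h , k))) = here (inj₁ (k , h))
  joins-resp-≃ (≃-flip _ _ p) (there j) = there (joins-resp-≃ p j)
  joins-resp-≃ (≃-swap _ _) (here h) = there (here h)
  joins-resp-≃ (≃-swap _ _) (there (here h)) = here h
  joins-resp-≃ (≃-swap _ _) (there (there j)) = there (there j)
  joins-resp-≃ (≃-trans p q) j = joins-resp-≃ q (joins-resp-≃ p j)

  pull : ∀ {es e} → e ∈ es → ∃ λ fs → es ≃ e ∷ fs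
  pull {e ∷ es} (here refl) = es , ≃-refl
  pull {f ∷ es} (there e∈) with fs , p ← pull e∈ = f ∷ fs , ≃-trans (≃-prep f p) (≃-swap f _)

  pull-end : ∀ {es v} → v ∈ ends es → ∃ λ w → ∃ λ fs → es ≃ (v , w) ∷ fs
  pull-end v∈ with ends⇒∈ v∈
  ... | w , inj₁ e∈ with fs , p ← pull e∈ = w , fs , p
  ... | w , inj₂ e∈ with fs , p ← pull e∈ = w , fs , ≃-trans p (≃-flip w _ ≃-refl)

  -- Used to make the end that is adjacent to the centre, the foot, the first end of every leg.
  orient : ∀ {P : Fin n → Set} es → (∀ {a b} → (a , b) ∈ es → P a ⊎ P b) →
    ∃ λ fs → es ≃ fs × All (P ∘ proj₁) fs
  orient [] _ = [] , ≃-refl , []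
  orient ((a , b) ∷ es) h with orient es (h ∘ there) | h (here refl)
  ... | fs , p , ps | inj₁ pa = (a , b) ∷ fs , ≃-prep _ p , pa ∷ ps
  ... | fs , p , ps | inj₂ pb = (b , a) ∷ fs , ≃-flip a b p , pb ∷ ps

  Unique-resp-↭ : ∀ {xs ys : List (Fin n)} → xs ↭ ys → Unique xs → Unique ys
  Unique-resp-↭ p = PermSetoid.Unique-resp-↭ (setoid _) (↭⇒↭ₛ p)

  -- Each vertex of xs spoils at most one edge of a matching.
  avoid : ∀ es xs → Unique (ends es) → length xs < length es →
    ∃ λ a → ∃ λ b → (a , b) ∈ es × a ∉ xs × b ∉ xs
  avoid ((a , b) ∷ es) xs ((_ ∷ a∉) ∷ b∉ ∷ u) lt with (a ∈? xs) ⊎-dec (b ∈? xs)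
  ... | no ¬h = a , b , here refl , ¬h ∘ inj₁ , ¬h ∘ inj₂
  ... | yes h = [ drop (All¬⇒¬Any a∉) , drop (All¬⇒¬Any b∉) ] h
    where
    -- A vertex `v` of `xs` on the first edge lies on no later one, by disjointness. It can be
    -- deleted from `xs` before recursing, and the edge found still avoids `v`.
    drop : ∀ {v} → v ∉ ends es → v ∈ xs → ∃ λ c → ∃ λ d → (c , d) ∈ (a , b) ∷ es × c ∉ xs × d ∉ xs
    drop {v} v∉ v∈ with c , d , e∈ , c∉ , d∉ ← avoid es (filter (λ w → ¬? (w ≟ v)) xs) u
        (<-≤-trans (filter-notAll (λ w → ¬? (w ≟ v)) xs (lose v∈ λ h → h refl)) (s≤s⁻¹ lt)) =
      c , d , there e∈ ,
      (λ c∈ → c∉ (∈-filter⁺ _ c∈ λ { refl → v∉ (joins-endˡ (∈⇒joins e∈)) })) ,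
      (λ d∈ → d∉ (∈-filter⁺ _ d∈ λ { refl → v∉ (joins-endˡ (joins-sym (∈⇒joins e∈))) }))

-- The tree T^{s+4}_{s,t} is the spider with s + 2 legs and t pendants: v₂ is the centre, the feet are
-- v₁, v₃, p₁, …, p_s, and the toes are v₀, v₄, q₁, …, q_s.
data Node (l t : ℕ) : Set where
  centre   : Node l t
  foot toe : Fin l → Node l t
  pendant  : Fin t → Node l t

data Arc {l t : ℕ} : Node l t → Node l t → Set where
  leg  : ∀ i → Arc centre (foot i)
  shin : ∀ i → Arc (foot i) (toe i)
  hair : ∀ j → Arc centre (pendant j)

NodeAdj : ∀ {l t} → Node l t → Node l t → Set
NodeAdj a b = Arc a b ⊎ Arc b a

record Spider {n} (G : Graph n) (l t : ℕ) : Set where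
  field
    nodes : Fin n ↔ Node l t
  open Inverse nodes public using () renaming (to to node; from to vertex)
  field
    adj⇔ : ∀ a b → Adj G (vertex a) (vertex b) ≡ true ⇔ NodeAdj a b

-- Matchings and coverings in a graph

module _ {n : ℕ} (G : Graph n) where

  open import Data.List.Membership.DecPropositional (_≟_ {n}) using (_∈?_)

  _~_ : Fin n → Fin n → Set
  u ~ v = Adj G u v ≡ true

  _~?_ : ∀ u v → Dec (u ~ v)
  u ~? v = Adj G u v Bool.≟ true

  ~-sym : ∀ {u v} → u ~ v → v ~ u
  ~-sym {u} {v} = trans (sym G v u)

  ~-irrefl : ∀ {u v} → u ~ v → u ≢ v
  ~-irrefl {u} p refl = case trans (≡-sym p) (irrefl G u) of λ ()

  Linked : Edges n → Set
  Linked = All λ (a , b) → a ~ b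

  record Matching (es : Edges n) : Set where
    constructor matching
    field
      linked   : Linked es
      disjoint : Unique (ends es)
  open Matching

  joins⇒~ : ∀ {es a b} → Linked es → Joins es a b → a ~ b
  joins⇒~ (p ∷ _) (here (inj₁ (refl , refl))) = p
  joins⇒~ (p ∷ _) (here (inj₂ (refl , refl))) = ~-sym p
  joins⇒~ (_ ∷ ps) (there j) = joins⇒~ ps j

  Linked-resp-≃ : ∀ {es fs} → es ≃ fs → Linked es → Linked fs
  Linked-resp-≃ ≃-refl ps = ps
  Linked-resp-≃ (≃-prep _ r) (p ∷ ps) = p ∷ Linked-resp-≃ r ps
  Linked-resp-≃ (≃-flip _ _ r) (p ∷ ps) = ~-sym p ∷ Linked-resp-≃ r ps
  Linked-resp-≃ (≃-swap _ _) (p ∷ q ∷ ps) = q ∷ p ∷ ps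
  Linked-resp-≃ (≃-trans r s) ps = Linked-resp-≃ s (Linked-resp-≃ r ps)

  Matching-resp-≃ : ∀ {es fs} → es ≃ fs → Matching es → Matching fs
  Matching-resp-≃ r (matching l u) = matching (Linked-resp-≃ r l) (Unique-resp-↭ (ends-↭ r) u)

  edgeRel-packing : ∀ {es} → Linked es → (∀ v → degIn (edgeRel es) v ≤ 2) → IsTwoPacking G (edgeRel es)
  edgeRel-packing {es} l deg = record
    { sub = λ i j → joins⇒~ l ∘ does⇒ (joins? es i j)
    ; symR = edgeRel-sym es
    ; deg≤2 = deg
    }

  exit : ∀ {xs u v} → u ∈ xs → v ∉ xs → Reach G u v → ∃ λ a → ∃ λ b → a ∈ xs × b ∉ xs × a ~ b
  exit u∈ v∉ here = contradiction u∈ v∉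
  exit {xs} u∈ v∉ (step {u} {w} p r) with w ∈? xs
  ... | yes w∈ = exit w∈ v∉ r
  ... | no w∉ = u , w , u∈ , w∉ , p

  Covers : List (Fin n) → Fin n → Set
  Covers xs v = v ∈ xs ⊎ Any (_~ v) xs

  covers? : ∀ xs v → Dec (Covers xs v)
  covers? xs v = (v ∈? xs) ⊎-dec Any.any? (_~? v) xs

  members-dominating : ∀ {xs} → (∀ v → Covers xs v) → Dominating G (members xs)
  members-dominating {xs} h v with h v
  ... | inj₁ v∈ = inj₁ (members-∈ {xs = xs} v∈)
  ... | inj₂ p with u , u∈ , u~v ← find p = inj₂ (u , members-∈ {xs = xs} u∈ , u~v)

  Extra : Edges n → Fin n → Fin n → Set
  Extra es a b = a ~ b × ¬ Joins es a b

  extra-sym : ∀ {es a b} → Extra es a b → Extra es b a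
  extra-sym (p , ¬j) = ~-sym p , ¬j ∘ joins-sym

  Centre : Edges n → Fin n → Set
  Centre es c = c ∈ ends es × (∀ {u v} → Extra es u v → c ∈ u ∷ v ∷ [])

  Centre-resp-≃ : ∀ {es fs c} → es ≃ fs → Centre es c → Centre fs c
  Centre-resp-≃ r (c∈ , on-edge) =
    ∈-resp-↭ (ends-↭ r) c∈ , λ (p , ¬j) → on-edge (p , ¬j ∘ joins-resp-≃ r)

  -- Existence of a matching with m edges when γ ≥ m

  module _ (conn : Connected G) {m : ℕ} (4≤m : 4 ≤ m)
    (packing≤ : ∀ R → IsTwoPacking G R → sizeE R ≤ suc m)
    (dominating≥ : ∀ D → Dominating G D → m ≤ sizeV D) where

    -- Read as a vertex set, the list has fewer than `m` members and cannot dominate; covering is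
    -- decidable and the graph finite, so a vertex left out can be found.
    undominated : ∀ xs → length xs < m → ∃ λ v → ¬ Covers xs v
    undominated xs lt with any? (¬? ∘ covers? xs)
    ... | yes h = h
    ... | no ¬h = contradiction
      (≤-trans (s≤s (dominating≥ (members xs)
        (members-dominating {xs} λ v → decidable-stable (covers? xs v) (¬h ∘ (v ,_)))))
        (≤-trans (s≤s (sizeV-members≤ xs)) lt))
      (<-irrefl refl)

    -- Some vertex is missed by `xs`, and a walk to it from `u` has to step out of `xs`.
    leave : ∀ {xs u} → u ∈ xs → length xs < m → ∃ λ a → ∃ λ b → a ∈ xs × b ∉ xs × a ~ b
    leave {xs} {u} u∈ lt with v , ¬c ← undominated xs lt = exit u∈ (¬c ∘ inj₁) (conn u v)

    neighbour : ∀ v → ∃ λ w → v ~ w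
    neighbour v with leave {v ∷ []} (here refl) (≤-trans (s≤s (s≤s z≤n)) 4≤m)
    ... | _ , w , here refl , _ , v~w = w , v~w

    -- One picked end per edge gives fewer than `m` vertices, so some `v` is uncovered. Both ends of
    -- every matching edge are covered, hence `v` is unmatched. A neighbour of `v` is either
    -- unmatched, which gives a new edge, or matched, which gives an augmenting path with three
    -- edges.
    augment : ∀ {es} → Matching es → length es < m →
      ∃ λ fs → Matching fs × length fs ≡ suc (length es)
    augment {es} M lt = go (undominated (map pick es) (subst (_< m) (≡-sym (length-map pick es)) lt))
      where
      exposed? : ∀ x → Dec (∃ λ u → u ∉ ends es × x ~ u)
      exposed? x = any? λ u → ¬? (u ∈? ends es) ×-dec (x ~? u)

      -- Each edge is represented by an end that sees an unmatched vertex, if it has one.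
      pick : Fin n × Fin n → Fin n
      pick (x , y) = if does (exposed? x) then x else y

      pick-endpoint : ∀ x y → pick (x , y) ≡ x ⊎ pick (x , y) ≡ y
      pick-endpoint x y with does (exposed? x)
      ... | true = inj₁ refl
      ... | false = inj₂ refl

      pick-∈ : ∀ {x y} → (x , y) ∈ es → pick (x , y) ∈ map pick es
      pick-∈ = ∈-map⁺ pick

      covered-edge : ∀ {x y} → (x , y) ∈ es → Covers (map pick es) x × Covers (map pick es) y
      covered-edge {x} {y} e∈ with pick-∈ e∈ | pick-endpoint x y | All.lookup (linked M) e∈
      ... | p∈ | inj₁ eq | x~y rewrite eq = inj₁ p∈ , inj₂ (lose p∈ x~y)
      ... | p∈ | inj₂ eq | x~y rewrite eq = inj₂ (lose p∈ (~-sym x~y)) , inj₁ p∈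

      go : (∃ λ v → ¬ Covers (map pick es) v) → ∃ λ fs → Matching fs × length fs ≡ suc (length es)
      go (v , ¬c) = extend (neighbour v)
        where
        v∉ : v ∉ ends es
        v∉ v∈ with ends⇒∈ v∈
        ... | _ , inj₁ e∈ = ¬c (proj₁ (covered-edge e∈))
        ... | _ , inj₂ e∈ = ¬c (proj₂ (covered-edge e∈))

        pick≁v : ∀ {x y} → (x , y) ∈ es → ¬ (pick (x , y) ~ v)
        pick≁v e∈ p~v = ¬c (inj₂ (lose (pick-∈ e∈) p~v))

        lengthen : ∀ {x y} → (x , y) ∈ es → y ~ v → (∃ λ u → u ∉ ends es × x ~ u × u ≢ v) →
          ∃ λ fs → Matching fs × length fs ≡ suc (length es)
        lengthen {x} {y} e∈ y~v (u , u∉ , x~u , u≢v) with fs , r ← pull e∈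
          with matching (_ ∷ l) d ← Matching-resp-≃ r M =
          -- Augmentation along the path `u`, `x`, `y`, `v`: its middle edge is replaced by the two
          -- outer ones.
          (x , u) ∷ (y , v) ∷ fs ,
          matching (x~u ∷ y~v ∷ l)
            (Unique-resp-↭ reorder ((u≢v ∷ ¬Any⇒All¬ _ (u∉ ∘ back)) ∷ ¬Any⇒All¬ _ (v∉ ∘ back) ∷ d)) ,
          cong suc (≡-sym (≃-length r))
          where
          back : ∀ {z} → z ∈ x ∷ y ∷ ends fs → z ∈ ends es
          back = ∈-resp-↭ (↭-sym (ends-↭ r))
          reorder : u ∷ v ∷ x ∷ y ∷ ends fs ↭ x ∷ u ∷ y ∷ v ∷ ends fs
          reorder = ↭-trans (prep u (swap v x ↭-refl)) (swap u x (swap v y ↭-refl))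

        -- The picked end does not see `v`, so the other end does. If `y` was picked, `x` sees no
        -- unmatched vertex, not even `v`; so `x` was picked, for an unmatched `u` which differs
        -- from `v`.
        through : ∀ {x y} → (x , y) ∈ es → x ~ v ⊎ y ~ v →
          ∃ λ fs → Matching fs × length fs ≡ suc (length es)
        through {x} {y} e∈ h with exposed? x | pick≁v e∈
        ... | no ¬e | q with h
        ...   | inj₁ x~v = contradiction (v , v∉ , x~v) ¬e
        ...   | inj₂ y~v = contradiction y~v q
        through {x} {y} e∈ h | yes (u , u∉ , x~u) | q with h
        ...   | inj₁ x~v = contradiction x~v q
        ...   | inj₂ y~v = lengthen e∈ y~v (u , u∉ , x~u , λ { refl → q x~u })

        extend : (∃ λ w → v ~ w) → ∃ λ fs → Matching fs × length fs ≡ suc (length es)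
        extend (w , v~w) with w ∈? ends es
        ... | no w∉ = (v , w) ∷ es ,
          matching (v~w ∷ linked M)
            ((~-irrefl v~w ∷ ¬Any⇒All¬ _ v∉) ∷ ¬Any⇒All¬ _ w∉ ∷ disjoint M) , refl
        ... | yes w∈ with ends⇒∈ w∈
        ...   | _ , inj₁ e∈ = through e∈ (inj₁ (~-sym v~w))
        ...   | _ , inj₂ e∈ = through e∈ (inj₂ (~-sym v~w))

    matching-of-length : ∀ j → j ≤ m → ∃ λ es → Matching es × length es ≡ j
    matching-of-length zero _ = [] , matching [] [] , refl
    matching-of-length (suc j) lt with matching-of-length j (≤-trans (n≤1+n j) lt)
    ... | es , M , refl = augment M lt

    -- Edges outside the matching pass through one vertex

    module _ {es : Edges n} (M : Matching es) (size : length es ≡ m) where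

      -- Two edges outside the matching that do not share a matched vertex would extend it to a
      -- 2-packing with m + 2 edges.
      meet : ∀ {a b c d} → Extra es a b → Extra es c d → c ∉ a ∷ b ∷ [] →
        d ∈ a ∷ b ∷ [] × d ∈ ends es
      meet {a} {b} {c} {d} (a~b , ¬ab) (c~d , ¬cd) c∉
        with (d ∈? a ∷ b ∷ []) ×-dec (d ∈? ends es)
      ... | yes h = h
      ... | no ¬h = contradiction
        (≤-trans (s≤s (s≤s (≤-trans (≤-reflexive (≡-sym size)) (length≤sizeE-edgeRel (disjoint M)))))
          (≤-trans (s≤s (sizeE-edgeRel-∷ (~-irrefl a~b) ¬ab))
            (≤-trans (sizeE-edgeRel-∷ (~-irrefl c~d) fresh)
              (packing≤ _ (edgeRel-packing (c~d ∷ a~b ∷ linked M) deg)))))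
        (<-irrefl refl)
        where
        fresh : ¬ Joins ((a , b) ∷ es) c d
        fresh (here (inj₁ (a≡c , _))) = c∉ (here (≡-sym a≡c))
        fresh (here (inj₂ (_ , b≡c))) = c∉ (there (here (≡-sym b≡c)))
        fresh (there j) = ¬cd j

        deg-∉ab : ∀ {v} → v ∉ a ∷ b ∷ [] → degIn (edgeRel ((a , b) ∷ es)) v ≤ 1
        deg-∉ab v∉ = ≤-trans (degIn-∷-∉ a b es (v∉ ∘ here) (v∉ ∘ there ∘ here)) (degIn-Unique (disjoint M) _)

        -- As `c` is neither `a` nor `b`, the new edges can share only `d`. If they do, `d` is
        -- unmatched by `¬h` and has degree two; any other vertex is on at most one matching edge
        -- and one new edge.
        deg : ∀ v → degIn (edgeRel ((c , d) ∷ (a , b) ∷ es)) v ≤ 2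
        deg v with v ∈? a ∷ b ∷ []
        ... | no v∉ = ≤-trans (degIn-∷ c d ((a , b) ∷ es) v) (s≤s (deg-∉ab v∉))
        ... | yes v∈ with v ≟ d
        ...   | no v≢d = ≤-trans (degIn-∷-∉ c d ((a , b) ∷ es) (λ { refl → c∉ v∈ }) v≢d)
          (≤-trans (degIn-∷ a b es v) (s≤s (degIn-Unique (disjoint M) v)))
        ...   | yes refl = ≤-trans (degIn-∷ c d ((a , b) ∷ es) v)
          (s≤s (≤-trans (degIn-∷ a b es v) (s≤s (degIn-∉ {es = es} (¬h ∘ (v∈ ,_))))))

      -- Two vertices are fewer than `m`, so an edge leaves them. It is not in the matching, where
      -- `x` and `y` have only each other as partners.
      leave-edge : ∀ {x y} → (x , y) ∈ es →
        ∃ λ a → ∃ λ b → a ∈ x ∷ y ∷ [] × b ∉ x ∷ y ∷ [] × Extra es a b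
      leave-edge {x} {y} e∈
        with leave {x ∷ y ∷ []} (here refl) (≤-trans (s≤s (s≤s (s≤s z≤n))) 4≤m)
      ... | a , b , a∈ , b∉ , a~b = a , b , a∈ , b∉ , a~b , (b∉ ∘ closed a∈)
        where
        closed : ∀ {a b} → a ∈ x ∷ y ∷ [] → Joins es a b → b ∈ x ∷ y ∷ []
        closed (here refl) j = there (here (partner-unique (disjoint M) j (∈⇒joins e∈)))
        closed (there (here refl)) j = here (partner-unique (disjoint M) j (joins-sym (∈⇒joins e∈)))

      -- At least four disjoint edges cannot all be hit by three vertices; an edge leaving one that
      -- is missed starts off `xs`. The bound on ν₂ enters here.
      extra-avoiding : ∀ xs → length xs < 4 → ∃ λ a → ∃ λ b → a ∉ xs × Extra es a b
      extra-avoiding xs lt with avoid es xs (disjoint M) (≤-trans lt (≤-trans 4≤m (≤-reflexive (≡-sym size))))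
      ... | x , y , e∈ , x∉ , y∉ with leave-edge e∈
      ...   | a , b , here refl , _ , ex = a , b , x∉ , ex
      ...   | a , b , there (here refl) , _ , ex = a , b , y∉ , ex

      -- An edge missing the common end of three others would have to contain their three other ends.
      claw⇒centre : ∀ {c x y z} → c ∈ ends es → x ≢ y → x ≢ z → y ≢ z →
        Extra es c x → Extra es c y → Extra es c z → Centre es c
      claw⇒centre {c} {x} {y} {z} c∈ x≢y x≢z y≢z cx cy cz = c∈ , on-edge
        where
        no-three : ∀ {u v} → x ∈ u ∷ v ∷ [] → y ∈ u ∷ v ∷ [] → z ∈ u ∷ v ∷ [] → ⊥
        no-three (here refl) (here y≡u) _ = x≢y (≡-sym y≡u)
        no-three (here refl) _ (here z≡u) = x≢z (≡-sym z≡u)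
        no-three (there (here refl)) (there (here y≡v)) _ = x≢y (≡-sym y≡v)
        no-three (there (here refl)) _ (there (here z≡v)) = x≢z (≡-sym z≡v)
        no-three _ (here refl) (here z≡u) = y≢z (≡-sym z≡u)
        no-three _ (there (here refl)) (there (here z≡v)) = y≢z (≡-sym z≡v)

        on-edge : ∀ {u v} → Extra es u v → c ∈ u ∷ v ∷ []
        on-edge {u} {v} uv with c ∈? u ∷ v ∷ []
        ... | yes c∈ = c∈
        ... | no c∉ = ⊥-elim (no-three (proj₁ (meet uv cx c∉)) (proj₁ (meet uv cy c∉)) (proj₁ (meet uv cz c∉)))

      -- A further edge `z w` with `z` off `c`, `p`, `q` must meet both given edges in `w`, so `w`
      -- is `c` and a claw arises. Taking `z` off all three vertices rules out a triangle.
      third : ∀ {c p q} → c ∈ ends es → Extra es c p → Extra es q c → q ≢ p → ∃ (Centre es)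
      third {c} {p} {q} c∈ cp qc q≢p
        with z , w , z∉ , zw ← extra-avoiding (c ∷ p ∷ q ∷ []) (s≤s (s≤s (s≤s (s≤s z≤n))))
        with meet cp zw (λ { (here h) → z∉ (here h) ; (there (here h)) → z∉ (there (here h)) })
           | meet qc zw (λ { (here h) → z∉ (there (there (here h))) ; (there (here h)) → z∉ (here h) })
      ... | here refl , _ | _ = c , claw⇒centre c∈ (q≢p ∘ ≡-sym)
            (z∉ ∘ there ∘ here ∘ ≡-sym) (z∉ ∘ there ∘ there ∘ here ∘ ≡-sym)
            cp (extra-sym {es} qc) (extra-sym {es} zw)
      ... | there (here refl) , _ | here p≡q , _ = contradiction (≡-sym p≡q) q≢p
      ... | there (here refl) , _ | there (here p≡c) , _ = contradiction (≡-sym p≡c) (~-irrefl (proj₁ cp))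

      -- Two edges outside the matching, the second starting off the first, share a matched vertex
      -- by `meet`, which is what `third` starts from.
      centre-exists : ∃ (Centre es)
      centre-exists with a , b , _ , ab ← extra-avoiding [] (s≤s z≤n)
        with x , y , x∉ , xy ← extra-avoiding (a ∷ b ∷ []) (s≤s (s≤s (s≤s z≤n)))
        with meet ab xy x∉
      ... | here refl , c∈ = third c∈ ab xy (x∉ ∘ there ∘ here)
      ... | there (here refl) , c∈ = third c∈ (extra-sym {es} ab) xy (x∉ ∘ here)

    -- The matching re-oriented so that its first edge and all its other feet are at the centre.
    record Star : Set where
      field
        c d     : Fin n
        legs    : Edges n
        isMatch : Matching ((c , d) ∷ legs)
        size    : suc (length legs) ≡ m
        central : Centre ((c , d) ∷ legs) c
        feet    : ∀ {e} → e ∈ legs → c ~ proj₁ e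

    -- Some edge outside the matching leaves the pair `x`, `y`. It passes through `c`, which is not
    -- on this pair and is therefore its outer end.
    centre-touches : ∀ {c d es x y} → Matching ((c , d) ∷ es) → suc (length es) ≡ m →
      Centre ((c , d) ∷ es) c → (x , y) ∈ es → c ~ x ⊎ c ~ y
    centre-touches M size (_ , on-edge) e∈ with leave-edge M size (there e∈) | disjoint M
    ... | a , b , a∈ , b∉ , ab | (_ ∷ c∉) ∷ _ with on-edge ab | a∈
    ...   | there (here refl) | here refl = inj₁ (~-sym (proj₁ ab))
    ...   | there (here refl) | there (here refl) = inj₂ (~-sym (proj₁ ab))
    ...   | here refl | here refl = contradiction (joins-endˡ (∈⇒joins e∈)) (All¬⇒¬Any c∉)
    ...   | here refl | there (here refl) =
      contradiction (joins-endˡ (joins-sym (∈⇒joins e∈))) (All¬⇒¬Any c∉)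

    re-orient : ∀ {es c d fs} → Matching es → length es ≡ m → Centre es c → es ≃ (c , d) ∷ fs → Star
    re-orient {es} {c} {d} {fs} M size central r = record
      { c = c
      ; d = d
      ; legs = proj₁ oriented
      ; isMatch = Matching-resp-≃ r′ M
      ; size = trans (≡-sym (≃-length r′)) size
      ; central = Centre-resp-≃ r′ central
      ; feet = All.lookup (proj₂ (proj₂ oriented))
      }
      where
      oriented : ∃ λ gs → fs ≃ gs × All ((c ~_) ∘ proj₁) gs
      oriented = orient fs (centre-touches (Matching-resp-≃ r M)
        (trans (≡-sym (≃-length r)) size) (Centre-resp-≃ r central))
      r′ : es ≃ (c , d) ∷ proj₁ oriented
      r′ = ≃-trans r (≃-prep _ (proj₁ (proj₂ oriented)))

    star : Star
    star =
      let es , M , size = matching-of-length m ≤-refl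
          c , central = centre-exists M size
          d , fs , r = pull-end (proj₁ central)
      in re-orient M size central r

    -- The star is a spider

    module _ (S : Star) where
      open Star S

      matched : Edges n
      matched = (c , d) ∷ legs

      c∉legs : c ∉ ends legs
      c∉legs with disjoint isMatch
      ... | (_ ∷ c∉) ∷ _ = All¬⇒¬Any c∉

      d∉legs : d ∉ ends legs
      d∉legs with disjoint isMatch
      ... | _ ∷ d∉ ∷ _ = All¬⇒¬Any d∉

      legs-disjoint : Unique (ends legs)
      legs-disjoint with disjoint isMatch
      ... | _ ∷ _ ∷ u = u

      c~d : c ~ d
      c~d = All.head (linked isMatch)

      -- Any edge at an unmatched vertex is outside the matching, so its other end is the centre.
      unmatched-~-centre : ∀ {v} → v ∉ ends matched → v ~ c
      unmatched-~-centre {v} v∉ with neighbour v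
      ... | w , v~w with proj₂ central (v~w , v∉ ∘ joins-endˡ)
      ...   | here refl = contradiction (here refl) v∉
      ...   | there (here refl) = v~w

      -- If both ends of a leg were adjacent to the centre, the centre and one end of each other leg
      -- would dominate.
      centre≁toe : ∀ {x y} → (x , y) ∈ legs → ¬ c ~ y
      centre≁toe {x} {y} e∈ c~y with K , r ← pull e∈ = absurd (undominated (c ∷ map proj₁ K) small)
        where
        -- The centre takes the place of the removed leg, so the list has as many vertices as there
        -- are legs, namely m - 1.
        small : suc (length (map proj₁ K)) < m
        small = ≤-reflexive (trans (cong (2 +_) (length-map proj₁ K))
          (trans (cong suc (≡-sym (≃-length r))) size))

        K-linked : Linked K
        K-linked = All.tail (linked (Matching-resp-≃ r (matching (All.tail (linked isMatch)) legs-disjoint)))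

        covered-∈ : ∀ {v} → v ∈ x ∷ y ∷ ends K → Covers (c ∷ map proj₁ K) v
        covered-∈ (here refl) = inj₂ (here (feet e∈))
        covered-∈ (there (here refl)) = inj₂ (here c~y)
        covered-∈ (there (there v∈)) with ends⇒∈ v∈
        ... | w , inj₁ f∈ = inj₁ (there (∈-map⁺ proj₁ f∈))
        ... | w , inj₂ f∈ = inj₂ (there (lose (∈-map⁺ proj₁ f∈) (All.lookup K-linked f∈)))

        absurd : (∃ λ v → ¬ Covers (c ∷ map proj₁ K) v) → ⊥
        absurd (v , ¬cov) with v ∈? ends matched
        ... | no v∉ = ¬cov (inj₂ (here (~-sym (unmatched-~-centre v∉))))
        ... | yes (here refl) = ¬cov (inj₁ (here refl))
        ... | yes (there (here refl)) = ¬cov (inj₂ (here c~d))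
        ... | yes (there (there v∈)) = ¬cov (covered-∈ (∈-resp-↭ (ends-↭ r) v∈))

      unmatched? : ∀ v → Dec (v ∉ ends matched)
      unmatched? v = ¬? (v ∈? ends matched)

      -- The partner `d` of the centre comes first: it guarantees a pendant and turns the matching
      -- edge at the centre into `hair zero`.
      hairs : List (Fin n)
      hairs = d ∷ filter unmatched? (allFin n)

      unmatched-hair : ∀ {v} → v ∈ filter unmatched? (allFin n) → v ∉ ends matched
      unmatched-hair v∈ = proj₂ (∈-filter⁻ unmatched? {xs = allFin n} v∈)

      hairs-unique : Unique hairs
      hairs-unique = ¬Any⇒All¬ _ (λ d∈ → unmatched-hair d∈ (there (here refl)))
        ∷ Unique.filter⁺ unmatched? (Unique.allFin⁺ n)

      hair~c : ∀ {v} → v ∈ hairs → c ~ v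
      hair~c (here refl) = c~d
      hair~c (there v∈) = ~-sym (unmatched-~-centre (unmatched-hair v∈))

      hair∉legs : ∀ {v} → v ∈ hairs → v ∉ ends legs
      hair∉legs (here refl) = d∉legs
      hair∉legs (there v∈) = unmatched-hair v∈ ∘ there ∘ there

      L = length legs
      H = length hairs

      at : Node L H → Fin n
      at centre = c
      at (foot i) = proj₁ (lookup legs i)
      at (toe i) = proj₂ (lookup legs i)
      at (pendant j) = lookup hairs j

      foot∈ : ∀ i → at (foot i) ∈ ends legs
      foot∈ i = lookup-end i (here refl)

      toe∈ : ∀ i → at (toe i) ∈ ends legs
      toe∈ i = lookup-end i (there (here refl))

      pendant∉ : ∀ j → at (pendant j) ∉ ends legs
      pendant∉ j = hair∉legs (∈-lookup j)

      c~foot : ∀ i → c ~ at (foot i)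
      c~foot i = feet (∈-lookup i)

      foot~toe : ∀ i → at (foot i) ~ at (toe i)
      foot~toe i = All.lookup (All.tail (linked isMatch)) (∈-lookup {xs = legs} i)

      c~pendant : ∀ j → c ~ at (pendant j)
      c~pendant j = hair~c (∈-lookup j)

      foot≢toe : ∀ i j → at (foot i) ≢ at (toe j)
      foot≢toe i j eq with lookup-end-unique legs-disjoint i j (here refl) (there (here eq))
      ... | refl = ~-irrefl (foot~toe i) eq

      -- The centre and the pendants are off the legs, the centre is adjacent to every pendant, and
      -- the ends of the legs are distinct.
      at-injective : ∀ a b → at a ≡ at b → a ≡ b
      at-injective centre centre _ = refl
      at-injective centre (foot i) eq = contradiction (subst (_∈ ends legs) (≡-sym eq) (foot∈ i)) c∉legs
      at-injective centre (toe i) eq = contradiction (subst (_∈ ends legs) (≡-sym eq) (toe∈ i)) c∉legs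
      at-injective centre (pendant j) eq = contradiction eq (~-irrefl (c~pendant j))
      at-injective (foot i) centre eq = contradiction (subst (_∈ ends legs) eq (foot∈ i)) c∉legs
      at-injective (foot i) (foot j) eq = cong foot (lookup-end-unique legs-disjoint i j (here refl) (here eq))
      at-injective (foot i) (toe j) eq = contradiction eq (foot≢toe i j)
      at-injective (foot i) (pendant j) eq = contradiction (subst (_∈ ends legs) eq (foot∈ i)) (pendant∉ j)
      at-injective (toe i) centre eq = contradiction (subst (_∈ ends legs) eq (toe∈ i)) c∉legs
      at-injective (toe i) (foot j) eq = contradiction (≡-sym eq) (foot≢toe j i)
      at-injective (toe i) (toe j) eq =
        cong toe (lookup-end-unique legs-disjoint i j (there (here refl)) (there (here eq)))
      at-injective (toe i) (pendant j) eq = contradiction (subst (_∈ ends legs) eq (toe∈ i)) (pendant∉ j)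
      at-injective (pendant j) centre eq = contradiction (≡-sym eq) (~-irrefl (c~pendant j))
      at-injective (pendant j) (foot i) eq = contradiction (subst (_∈ ends legs) (≡-sym eq) (foot∈ i)) (pendant∉ j)
      at-injective (pendant j) (toe i) eq = contradiction (subst (_∈ ends legs) (≡-sym eq) (toe∈ i)) (pendant∉ j)
      at-injective (pendant i) (pendant j) eq = cong pendant (Unique⇒lookup-injective hairs-unique i j eq)

      at-surjective : ∀ v → ∃ λ a → at a ≡ v
      at-surjective v with v ∈? ends matched
      ... | no v∉ = pendant (suc (Any.index v∈)) , ≡-sym (lookup-index v∈)
        where
        v∈ : v ∈ filter unmatched? (allFin n)
        v∈ = ∈-filter⁺ unmatched? (∈-allFin v) v∉
      ... | yes (here refl) = centre , refl
      ... | yes (there (here refl)) = pendant zero , refl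
      ... | yes (there (there v∈)) with ends⇒∈ v∈
      ...   | w , inj₁ e∈ = foot (Any.index e∈) , cong proj₁ (≡-sym (lookup-index e∈))
      ...   | w , inj₂ e∈ = toe (Any.index e∈) , cong proj₂ (≡-sym (lookup-index e∈))

      arc⇒~ : ∀ {a b} → Arc a b → at a ~ at b
      arc⇒~ (leg i) = c~foot i
      arc⇒~ (shin i) = foot~toe i
      arc⇒~ (hair j) = c~pendant j

      centre~⇒arc : ∀ b → c ~ at b → Arc centre b
      centre~⇒arc centre c~c = contradiction refl (~-irrefl c~c)
      centre~⇒arc (foot i) _ = leg i
      centre~⇒arc (toe i) c~y = contradiction c~y (centre≁toe (∈-lookup i))
      centre~⇒arc (pendant j) _ = hair j

      shin-between : ∀ {i} {a b : Node L H} → foot i ≡ a → toe i ≡ b → Arc a b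
      shin-between refl refl = shin _

      joins⇒arc : ∀ {a b} → Joins matched (at a) (at b) → NodeAdj a b
      joins⇒arc {a} {b} (here (inj₁ (p , q)))
        with refl ← at-injective centre a p | refl ← at-injective (pendant zero) b q = inj₁ (hair zero)
      joins⇒arc {a} {b} (here (inj₂ (p , q)))
        with refl ← at-injective centre b p | refl ← at-injective (pendant zero) a q = inj₂ (hair zero)
      joins⇒arc {a} {b} (there j) with lookup-index j
      ... | inj₁ (p , q) = inj₁ (shin-between (at-injective (foot i) a p) (at-injective (toe i) b q))
        where i = Any.index j
      ... | inj₂ (p , q) = inj₂ (shin-between (at-injective (foot i) b p) (at-injective (toe i) a q))
        where i = Any.index j

      -- A matching edge is `hair zero` or a shin. Any other edge goes through the centre, and by
      -- `centre≁toe` its other end is a foot or a pendant.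
      ~⇒arc : ∀ {a b} → at a ~ at b → NodeAdj a b
      ~⇒arc {a} {b} p with joins? matched (at a) (at b)
      ... | yes j = joins⇒arc j
      ... | no ¬j with proj₂ central (p , ¬j)
      ...   | here c≡a with refl ← at-injective centre a c≡a = inj₁ (centre~⇒arc b p)
      ...   | there (here c≡b) with refl ← at-injective centre b c≡b = inj₂ (centre~⇒arc a (~-sym p))

      star⇒spider : Spider G L H
      star⇒spider = record
        { nodes = mk↔ₛ′ (proj₁ ∘ at-surjective) at
            (λ a → at-injective _ _ (proj₂ (at-surjective (at a)))) (proj₂ ∘ at-surjective)
        ; adj⇔ = λ a b → mk⇔ ~⇒arc [ arc⇒~ , ~-sym ∘ arc⇒~ ]
        }

    extremal⇒spider : ∃ λ s → ∃ λ t → 1 ≤ s × 1 ≤ t × s + 4 ≡ suc m × Spider G (2 + s) t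
    extremal⇒spider = from-legs (Star.legs star) (Star.size star) (s≤s z≤n) (star⇒spider star)
      where
      from-legs : ∀ legs {t} → suc (length legs) ≡ m → 1 ≤ t → Spider G (length legs) t →
        ∃ λ s → ∃ λ t → 1 ≤ s × 1 ≤ t × s + 4 ≡ suc m × Spider G (2 + s) t
      -- There are m - 1 ≥ 3 legs. Two are set aside for v₂v₁v₀ and v₂v₃v₄, and the other s = m - 3
      -- ≥ 1 play the paths v₂pᵢqᵢ.
      from-legs (_ ∷ _ ∷ ls) eq 1≤t sp = length ls , _ ,
        s≤s⁻¹ (s≤s⁻¹ (s≤s⁻¹ (≤-trans 4≤m (≤-reflexive (≡-sym eq))))) , 1≤t ,
        trans (+-comm (length ls) 4) (cong suc eq) , sp
      from-legs [] eq = contradiction (≤-trans 4≤m (≤-reflexive (≡-sym eq))) λ { (s≤s ()) }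
      from-legs (_ ∷ []) eq = contradiction (≤-trans 4≤m (≤-reflexive (≡-sym eq))) λ { (s≤s (s≤s ())) }

-- The tree T as a spider

module _ {s t : ℕ} where

  Node′ : Set
  Node′ = Node (2 + s) t

  code : Node′ → ℕ
  code (toe zero) = 0
  code (foot zero) = 1
  code centre = 2
  code (foot (suc zero)) = 3
  code (toe (suc zero)) = 4
  code (foot (suc (suc i))) = 5 + toℕ i
  code (toe (suc (suc i))) = 5 + s + toℕ i
  code (pendant j) = 5 + s + s + toℕ j

  -- The nesting follows `5 + s + s + t`, so that splitting `Fin` along this sum produces exactly
  -- the numbering of `code`.
  blocks : Node′ ↔ (((Fin 5 ⊎ Fin s) ⊎ Fin s) ⊎ Fin t)
  blocks = mk↔ₛ′ f g fg gf
    where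
    f : Node′ → ((Fin 5 ⊎ Fin s) ⊎ Fin s) ⊎ Fin t
    f (toe zero) = inj₁ (inj₁ (inj₁ (Fin.# 0)))
    f (foot zero) = inj₁ (inj₁ (inj₁ (Fin.# 1)))
    f centre = inj₁ (inj₁ (inj₁ (Fin.# 2)))
    f (foot (suc zero)) = inj₁ (inj₁ (inj₁ (Fin.# 3)))
    f (toe (suc zero)) = inj₁ (inj₁ (inj₁ (Fin.# 4)))
    f (foot (suc (suc i))) = inj₁ (inj₁ (inj₂ i))
    f (toe (suc (suc i))) = inj₁ (inj₂ i)
    f (pendant j) = inj₂ j
    g : ((Fin 5 ⊎ Fin s) ⊎ Fin s) ⊎ Fin t → Node′
    g (inj₁ (inj₁ (inj₁ zero))) = toe zero
    g (inj₁ (inj₁ (inj₁ (suc zero)))) = foot zero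
    g (inj₁ (inj₁ (inj₁ (suc (suc zero))))) = centre
    g (inj₁ (inj₁ (inj₁ (suc (suc (suc zero)))))) = foot (suc zero)
    g (inj₁ (inj₁ (inj₁ (suc (suc (suc (suc zero))))))) = toe (suc zero)
    g (inj₁ (inj₁ (inj₂ i))) = foot (suc (suc i))
    g (inj₁ (inj₂ i)) = toe (suc (suc i))
    g (inj₂ j) = pendant j
    fg : ∀ x → f (g x) ≡ x
    fg (inj₁ (inj₁ (inj₁ zero))) = refl
    fg (inj₁ (inj₁ (inj₁ (suc zero)))) = refl
    fg (inj₁ (inj₁ (inj₁ (suc (suc zero))))) = refl
    fg (inj₁ (inj₁ (inj₁ (suc (suc (suc zero)))))) = refl
    fg (inj₁ (inj₁ (inj₁ (suc (suc (suc (suc zero))))))) = refl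
    fg (inj₁ (inj₁ (inj₂ i))) = refl
    fg (inj₁ (inj₂ i)) = refl
    fg (inj₂ j) = refl
    gf : ∀ x → g (f x) ≡ x
    gf (toe zero) = refl
    gf (foot zero) = refl
    gf centre = refl
    gf (foot (suc zero)) = refl
    gf (toe (suc zero)) = refl
    gf (foot (suc (suc i))) = refl
    gf (toe (suc (suc i))) = refl
    gf (pendant j) = refl

  numbering : Fin (Tsize s t) ↔ Node′
  numbering = ↔-sym blocks ↔-∘ (
    (((Fin.+↔⊎ ⊎-↔ ↔-id _) ↔-∘ Fin.+↔⊎) ⊎-↔ ↔-id _) ↔-∘ Fin.+↔⊎)

  number : Node′ → Fin (Tsize s t)
  number = Inverse.from numbering

  toℕ-number : ∀ a → toℕ (number a) ≡ code a
  toℕ-number (toe zero) = refl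
  toℕ-number (foot zero) = refl
  toℕ-number centre = refl
  toℕ-number (foot (suc zero)) = refl
  toℕ-number (toe (suc zero)) = refl
  toℕ-number (foot (suc (suc i))) = trans (Fin.toℕ-↑ˡ _ t) (trans (Fin.toℕ-↑ˡ _ s) (Fin.toℕ-↑ʳ 5 i))
  toℕ-number (toe (suc (suc i))) = trans (Fin.toℕ-↑ˡ _ t) (Fin.toℕ-↑ʳ (5 + s) i)
  toℕ-number (pendant j) = Fin.toℕ-↑ʳ (5 + s + s) j

  number-injective : ∀ {a b} → number a ≡ number b → a ≡ b
  number-injective {a} {b} eq = trans (≡-sym (Inverse.strictlyInverseˡ numbering a))
    (trans (cong (Inverse.to numbering) eq) (Inverse.strictlyInverseˡ numbering b))

  code-injective : ∀ {a b} → code a ≡ code b → a ≡ b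
  code-injective {a} {b} eq = number-injective (Fin.toℕ-injective
    (trans (toℕ-number a) (trans eq (≡-sym (toℕ-number b)))))

  -- The orientation is left open because the list has v₀v₁ and v₁v₂ pointing towards the centre,
  -- whereas arcs point away from it.
  Tedges-sound : ∀ {e} → e ∈ Tedges s t → ∃ λ a → ∃ λ b → NodeAdj a b × e ≡ (code a , code b)
  Tedges-sound e∈ with ∈-++⁻ ((0 , 1) ∷ (1 , 2) ∷ (2 , 3) ∷ (3 , 4) ∷ []) e∈
  ... | inj₁ (here refl) = _ , _ , inj₂ (shin zero) , refl
  ... | inj₁ (there (here refl)) = _ , _ , inj₂ (leg zero) , refl
  ... | inj₁ (there (there (here refl))) = _ , _ , inj₁ (leg (suc zero)) , refl
  ... | inj₁ (there (there (there (here refl)))) = _ , _ , inj₁ (shin (suc zero)) , refl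
  ... | inj₂ e∈ with ∈-++⁻ (map (λ i → (5 + i , 5 + s + i)) (upTo s)) e∈
  ...   | inj₁ e∈ with i , i∈ , refl ← ∈-map⁻ _ e∈ with i<s ← ∈-upTo⁻ i∈ =
    _ , _ , inj₁ (shin (suc (suc (Fin.fromℕ< i<s)))) ,
    cong (λ i → (5 + i , 5 + s + i)) (≡-sym (Fin.toℕ-fromℕ< i<s))
  ...   | inj₂ e∈ with ∈-++⁻ (map (λ i → (2 , 5 + s + s + i)) (upTo t)) e∈
  ...     | inj₁ e∈ with i , i∈ , refl ← ∈-map⁻ _ e∈ with i<t ← ∈-upTo⁻ i∈ =
    _ , _ , inj₁ (hair (Fin.fromℕ< i<t)) ,
    cong (λ i → (2 , 5 + s + s + i)) (≡-sym (Fin.toℕ-fromℕ< i<t))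
  ...     | inj₂ e∈ with i , i∈ , refl ← ∈-map⁻ _ e∈ with i<s ← ∈-upTo⁻ i∈ =
    _ , _ , inj₁ (leg (suc (suc (Fin.fromℕ< i<s)))) ,
    cong (λ i → (2 , 5 + i)) (≡-sym (Fin.toℕ-fromℕ< i<s))

  Tedges-complete : ∀ {a b} → Arc a b → (code a , code b) ∈ Tedges s t ⊎ (code b , code a) ∈ Tedges s t
  Tedges-complete (shin zero) = inj₂ (here refl)
  Tedges-complete (leg zero) = inj₂ (there (here refl))
  Tedges-complete (leg (suc zero)) = inj₁ (there (there (here refl)))
  Tedges-complete (shin (suc zero)) = inj₁ (there (there (there (here refl))))
  Tedges-complete (shin (suc (suc i))) = inj₁ (there (there (there (there
    (∈-++⁺ˡ (∈-map⁺ _ (∈-upTo⁺ (Fin.toℕ<n i))))))))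
  Tedges-complete (hair j) = inj₁ (there (there (there (there
    (∈-++⁺ʳ (map _ (upTo s)) (∈-++⁺ˡ (∈-map⁺ _ (∈-upTo⁺ (Fin.toℕ<n j)))))))))
  Tedges-complete (leg (suc (suc i))) = inj₁ (there (there (there (there
    (∈-++⁺ʳ (map _ (upTo s)) (∈-++⁺ʳ (map _ (upTo t)) (∈-map⁺ _ (∈-upTo⁺ (Fin.toℕ<n i)))))))))

  any⇒ : ∀ {A : Set} (p : A → Bool) xs → any p xs ≡ true → ∃ λ x → x ∈ xs × T (p x)
  any⇒ p xs h = find (any⁻ p xs (Equivalence.from Bool.T-≡ h))

  ⇒any : ∀ {A : Set} (p : A → Bool) {xs x} → x ∈ xs → T (p x) → any p xs ≡ true
  ⇒any p x∈ h = Equivalence.to Bool.T-≡ (any⁺ p (lose x∈ h))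

  Listed : ℕ → ℕ → Set
  Listed p q = (p , q) ∈ Tedges s t ⊎ (q , p) ∈ Tedges s t

  -- A copy of the local function in TAdj, which cannot be referred to by name.
  matchᵇ : ℕ → ℕ → ℕ × ℕ → Bool
  matchᵇ x y (p , q) = ((p ≡ᵇ x) ∧ (q ≡ᵇ y)) ∨ ((p ≡ᵇ y) ∧ (q ≡ᵇ x))

  TAdj≡any : ∀ x y → TAdj s t x y ≡ any (matchᵇ (toℕ x) (toℕ y)) (Tedges s t)
  TAdj≡any x y = refl

  any-match⇒listed : ∀ x y → any (matchᵇ x y) (Tedges s t) ≡ true → Listed x y
  any-match⇒listed x y h with (p , q) , e∈ , m ← any⇒ (matchᵇ x y) (Tedges s t) h =
    Sum.map (conv e∈ ∘ both) (conv e∈ ∘ both) (Equivalence.to Bool.T-∨ m)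
    where
    both : ∀ {p q x y} → T ((p ≡ᵇ x) ∧ (q ≡ᵇ y)) → p ≡ x × q ≡ y
    both {p} {q} {x} {y} h = let h₁ , h₂ = Equivalence.to (Bool.T-∧ {p ≡ᵇ x}) h in ≡ᵇ⇒≡ p x h₁ , ≡ᵇ⇒≡ q y h₂
    conv : ∀ {p q x y} → (p , q) ∈ Tedges s t → p ≡ x × q ≡ y → (x , y) ∈ Tedges s t
    conv e∈ (refl , refl) = e∈

  listed⇒any-match : ∀ x y → Listed x y → any (matchᵇ x y) (Tedges s t) ≡ true
  listed⇒any-match x y = [ (λ e∈ → ⇒any (matchᵇ x y) e∈ (Equivalence.from Bool.T-∨ (inj₁ (reflᵇ x y)))) ,
                           (λ e∈ → ⇒any (matchᵇ x y) e∈ (Equivalence.from Bool.T-∨ (inj₂ (reflᵇ y x)))) ]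
    where
    reflᵇ : ∀ x y → T ((x ≡ᵇ x) ∧ (y ≡ᵇ y))
    reflᵇ x y = Equivalence.from Bool.T-∧ (≡⇒≡ᵇ x x refl , ≡⇒≡ᵇ y y refl)

  listed⇒nodeAdj : ∀ {a b} → Listed (code a) (code b) → NodeAdj a b
  listed⇒nodeAdj = [ sound , Sum.swap ∘ sound ]
    where
    -- A listed pair comes with nodes of its own; they are the given ones because codes determine
    -- nodes.
    pinned : ∀ {a b} → (∃ λ c → ∃ λ d → NodeAdj c d × (code a , code b) ≡ (code c , code d)) → NodeAdj a b
    pinned (c , d , cd , eq) = subst₂ NodeAdj (code-injective (≡-sym (cong proj₁ eq))) (code-injective (≡-sym (cong proj₂ eq))) cd

    sound : ∀ {a b} → (code a , code b) ∈ Tedges s t → NodeAdj a b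
    sound e∈ = pinned (Tedges-sound e∈)

  TAdj-number⇔ : ∀ a b → TAdj s t (number a) (number b) ≡ true ⇔ NodeAdj a b
  TAdj-number⇔ a b = subst (λ p → p ≡ true ⇔ NodeAdj a b) (≡-sym at-codes) (mk⇔
    (λ h → listed⇒nodeAdj (any-match⇒listed (code a) (code b) h))
    (λ h → listed⇒any-match (code a) (code b) ([ Tedges-complete , Sum.swap ∘ Tedges-complete ] h)))
    where
    at-codes : TAdj s t (number a) (number b) ≡ any (matchᵇ (code a) (code b)) (Tedges s t)
    at-codes = trans (TAdj≡any (number a) (number b))
      (cong₂ (λ x y → any (matchᵇ x y) (Tedges s t)) (toℕ-number a) (toℕ-number b))

-- Spiders, isomorphism with T, and the domination number

module _ {n : ℕ} {G : Graph n} where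

  adj⇔node : ∀ {l t} (S : Spider G l t) → let open Spider S in
    ∀ u v → Adj G u v ≡ true ⇔ NodeAdj (node u) (node v)
  adj⇔node S u v = subst₂ (λ u′ v′ → Adj G u′ v′ ≡ true ⇔ NodeAdj (node u) (node v))
    (Inverse.strictlyInverseʳ nodes u) (Inverse.strictlyInverseʳ nodes v) (adj⇔ (node u) (node v))
    where open Spider S

  spider⇒IsoT : ∀ {s t} → Spider G (2 + s) t → IsoT G s t
  spider⇒IsoT S = ↔-sym numbering ↔-∘ nodes , λ u v →
    Bool.⇔→≡ (⇔-sym (TAdj-number⇔ (node u) (node v)) ⇔-∘ adj⇔node S u v)
    where open Spider S

  IsoT⇒spider : ∀ {s t} → IsoT G s t → Spider G (2 + s) t
  IsoT⇒spider {s} {t} (f , adj) = record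
    { nodes = numbering ↔-∘ f
    ; adj⇔ = λ a b → subst (λ p → p ≡ true ⇔ NodeAdj a b)
        (≡-sym (trans (adj _ _) (cong₂ (TAdj s t) (back a) (back b)))) (TAdj-number⇔ a b)
    }
    where
    back : ∀ a → Inverse.to f (Inverse.from f (number a)) ≡ number a
    back a = Inverse.strictlyInverseˡ f (number a)

  -- A dominating set meets each class, because only its class can dominate a toe or a pendant.
  spider⇒IsGamma : ∀ {l t} → 1 ≤ t → Spider G l t → IsGamma G (suc l)
  spider⇒IsGamma {l} {suc t} _ S =
    (members hub , members-dominating G {hub} covers , ≤-antisym
      (≤-trans (sizeV-members≤ hub) (≤-reflexive (length-tabulate (vertex ∘ inner))))
      (lower (members hub) (members-dominating G {hub} covers))) ,
    lower
    where
    open Spider S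

    class : Node l (suc t) → Fin (suc l)
    class centre = zero
    class (pendant _) = zero
    class (foot i) = suc i
    class (toe i) = suc i

    lower : ∀ D → Dominating G D → suc l ≤ sizeV D
    lower D dom = ≤-trans (≤-reflexive (≡-sym (length-tabulate rep)))
      (length≤sizeV (Unique.tabulate⁺ {f = rep} rep-injective) λ v∈ → case ∈-tabulate⁻ {f = rep} v∈ of λ where
        (i , refl) → proj₂ (proj₂ (hit i)))
      where
      -- No arc starts at a pendant or a toe, so a neighbour dominating one is the tail of its arc,
      -- the centre or the foot, and lies in the same class.
      hit : ∀ i → ∃ λ a → class a ≡ i × D (vertex a) ≡ true
      hit zero with dom (vertex (pendant zero))
      ... | inj₁ Dw = pendant zero , refl , Dw
      ... | inj₂ (u , Du , uw)
        with Equivalence.to (adj⇔ (node u) (pendant zero)) (trans (cong (λ v → Adj G v _) (Inverse.strictlyInverseʳ nodes u)) uw)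
      ...   | inj₁ arc = node u , class-hair arc , trans (cong D (Inverse.strictlyInverseʳ nodes u)) Du
        where
        class-hair : ∀ {a} → Arc a (pendant zero) → class a ≡ zero
        class-hair (hair _) = refl
      hit (suc i) with dom (vertex (toe i))
      ... | inj₁ Dq = toe i , refl , Dq
      ... | inj₂ (u , Du , uq)
        with Equivalence.to (adj⇔ (node u) (toe i)) (trans (cong (λ v → Adj G v _) (Inverse.strictlyInverseʳ nodes u)) uq)
      ...   | inj₁ arc = node u , class-shin arc , trans (cong D (Inverse.strictlyInverseʳ nodes u)) Du
        where
        class-shin : ∀ {a} → Arc a (toe i) → class a ≡ suc i
        class-shin (shin _) = refl

      rep : Fin (suc l) → Fin n
      rep i = vertex (proj₁ (hit i))

      rep-injective : ∀ {i j} → rep i ≡ rep j → i ≡ j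
      rep-injective {i} {j} eq = trans (≡-sym (proj₁ (proj₂ (hit i))))
        (trans (cong class (trans (≡-sym (Inverse.strictlyInverseˡ nodes _))
          (trans (cong node eq) (Inverse.strictlyInverseˡ nodes _))))
        (proj₁ (proj₂ (hit j))))

    -- One vertex from each class, the centre and the feet: together they dominate, so the bound
    -- `lower` is attained.
    inner : Fin (suc l) → Node l (suc t)
    inner zero = centre
    inner (suc i) = foot i

    hub : List (Fin n)
    hub = tabulate (vertex ∘ inner)

    in-hub : ∀ i → vertex (inner i) ∈ hub
    in-hub = ∈-tabulate⁺ {f = vertex ∘ inner}

    covers-node : ∀ a → Covers G hub (vertex a)
    covers-node centre = inj₁ (in-hub zero)
    covers-node (foot i) = inj₁ (in-hub (suc i))
    covers-node (toe i) = inj₂ (lose (in-hub (suc i)) (Equivalence.from (adj⇔ (foot i) (toe i)) (inj₁ (shin i))))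
    covers-node (pendant j) = inj₂ (lose (in-hub zero) (Equivalence.from (adj⇔ centre (pendant j)) (inj₁ (hair j))))

    covers : ∀ v → Covers G hub v
    covers v = subst (Covers G hub) (Inverse.strictlyInverseʳ nodes v) (covers-node (node v))

theorem3p7 : ∀ {n} (G : Graph n) → Connected G → (k : ℕ) → IsNu2 G k →
    k < edgeCount G → 5 ≤ k →
    (IsGamma G (k ∸ 1) ⇔
    Σ ℕ λ s → Σ ℕ λ t → 1 ≤ s × 1 ≤ t × s + 4 ≡ k × IsoT G s t)
theorem3p7 G conn (suc m) (_ , packing≤) _ (s≤s 4≤m) = mk⇔ to from
  where
  Tree : Set
  Tree = Σ ℕ λ s → Σ ℕ λ t → 1 ≤ s × 1 ≤ t × s + 4 ≡ suc m × IsoT G s t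

  spider⇒tree : (∃ λ s → ∃ λ t → 1 ≤ s × 1 ≤ t × s + 4 ≡ suc m × Spider G (2 + s) t) → Tree
  spider⇒tree (s , t , 1≤s , 1≤t , eq , S) = s , t , 1≤s , 1≤t , eq , spider⇒IsoT S

  to : IsGamma G m → Tree
  to (_ , dominating≥) = spider⇒tree (extremal⇒spider G conn 4≤m packing≤ dominating≥)

  from : Tree → IsGamma G m
  -- A spider with s + 2 legs has γ = s + 3, and s + 4 = m + 1 makes this `m`.
  from (s , t , _ , 1≤t , eq , iso) = subst (IsGamma G) (suc-injective (trans (+-comm 4 s) eq))
    (spider⇒IsGamma {G = G} 1≤t (IsoT⇒spider iso))
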